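{- Let $M$ be a matroid of rank $r(M)$ on the ground set $E=[n]=\{1,\dots,n\}$, and let $C$ be a circuit of $M$. Then $$\beta_C=\sum_{t=|C|}^{r(M)+1}\beta_C(t),$$ where, for $|C|\le t\le r(M)+1$, $$\beta_C(t)=\frac{|C|}{n}\cdot|\mathcal{I}_{C,\,t-|C|}|\cdot\binom{n-1}{t-1}^{ -1}.$$ Here $\mathcal{I}_{C,k}$ denotes the collection of all $k$-element subsets $S$ of $E\setminus C$ such that $C$ is the unique circuit of $M$ contained in $S\cup C$.
   Context: Matroid bingo: let $M$ be a matroid on a finite set $E$ with $|E|=n$ and circuit set $\mathcal{C}$. The elements of $E$ are called out one at a time in a uniformly random order $\sigma(1),\sigma(2),\dots,\sigma(n)$ (a uniformly random permutation of $E$). A circuit $C$ wins in round $t$ if $C\subseteq\{\sigma(1),\dots,\sigma(t)\}$ and no circuit of $M$ is contained in $\{\sigma(1),\dots,\sigma(t-1)\}$; thus the winner is the first circuit to be completed (the circuit axioms guarantee that there is no tie). $\beta_C(t)$ denotes the probability that $C$ wins in round $t$ ($1\le t\le n$), and $\beta_C$ denotes the probability that $C$ wins (in some round). -}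

module Defs where

open import Data.Bool.Properties using () renaming (_≟_ to _≟ᵇ_)
open import Data.Fin.Base using (Fin; zero; suc; toℕ; punchIn; punchOut)
open import Data.Fin.Permutation
  using (Permutation′; _⟨$⟩ʳ_; insert; remove; insert-remove; _≈_) renaming (id to idₚ)
open import Data.Fin.Properties using (any?; _≟_)
open import Data.Fin.Subset
open import Data.Fin.Subset.Properties
  using (_⊆?_; anySubset?; ∣p∣≤n; ∣p∣≡n⇒p≡⊤; ⊆⊤)
open import Data.Integer.Base using (+_)
open import Data.List.Base
  using (List; []; _∷_; _++_; map; filter; foldr; length; take; allFin; applyUpTo; cartesianProductWith)
open import Data.List.Extrema.Nat using (max; max<v⁺)
open import Data.List.Membership.Propositional.Properties
  using (∈-allFin)
open import Data.List.Properties using (length-++; length-map; length-tabulate)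
open import Data.List.Relation.Unary.All as All using (All)
open import Data.List.Relation.Unary.All.Properties as All using (all-filter)
open import Data.List.Relation.Unary.Any using (Any; here)
open import Data.List.Relation.Unary.Any.Properties using (cartesianProductWith⁺)
open import Data.Nat.Base as ℕ
  using (ℕ; zero; suc; _∸_; _≤_; _<_; _!; NonZero; z≤n; s≤s)
open import Data.Nat.Combinatorics using ([n∸k]!k!∣n!; nCk≡n!/k![n-k]!)
  renaming (_C_ to _choose_) public
open import Data.Nat.Divisibility using (_∣_; ∣⇒≤)
open import Data.Nat.DivMod using (m≥n⇒m/n>0)
import Data.Nat.Properties as ℕ
open import Data.Product.Base using (∃; _×_; _,_)
open import Data.Rational.Base as ℚ using (ℚ; 0ℚ; _/_)
open import Data.Vec.Base using ([]; _∷_)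
open import Data.Vec.Properties using (≡-dec)
open import Level using (0ℓ)
open import Relation.Binary.PropositionalEquality
  using (_≡_; _≢_; refl; sym; trans; cong; cong₂; subst)
open import Relation.Nullary.Decidable using (Dec; yes; no; _×-dec_; ¬?; map′; decidable-stable)
open import Relation.Nullary.Negation using (¬_; contradiction)
open import Relation.Unary using (Pred; Decidable)

-- A matroid on the ground set Fin n, given by its circuits.  Decidability
-- is what makes the family of circuits a finite collection that can be counted.
record Matroid (n : ℕ) : Set₁ where
  field
    Circuit      : Pred (Subset n) 0ℓ
    circuit?     : Decidable Circuit
    ∅-nonCircuit : ¬ Circuit ⊥
    antichain    : ∀ {C D} → Circuit C → Circuit D → C ⊆ D → C ≡ D
    elimination  : ∀ {C D} → Circuit C → Circuit D → C ≢ D →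
                   ∀ {e} → e ∈ C → e ∈ D →
                   ∃ λ F → Circuit F × F ⊆ (C ∪ D) - e

open Matroid public

subsets : ∀ n → List (Subset n)
subsets zero    = [] ∷ []
subsets (suc n) = map (outside ∷_) (subsets n) ++ map (inside ∷_) (subsets n)

-- Each permutation of Fin n exactly once: choose the image of zero, then
-- arrange the remaining elements.
permutations : ∀ n → List (Permutation′ n)
permutations zero    = idₚ ∷ []
permutations (suc n) = cartesianProductWith (insert zero) (allFin (suc n)) (permutations n)

private
  length-cartesianProductWith :
    ∀ {A B C : Set} (f : A → B → C) xs ys →
    length (cartesianProductWith f xs ys) ≡ length xs ℕ.* length ys
  length-cartesianProductWith f []       ys = refl
  length-cartesianProductWith f (x ∷ xs) ys =
    trans (length-++ (map (f x) ys))
          (cong₂ ℕ._+_ (length-map (f x) ys) (length-cartesianProductWith f xs ys))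

  insert-cong : ∀ {n} (j : Fin (suc n)) {π ρ : Permutation′ n} →
                π ≈ ρ → insert zero j π ≈ insert zero j ρ
  insert-cong j π≈ρ k with zero ≟ k
  ... | yes _   = refl
  ... | no  0≢k = cong (punchIn j) (π≈ρ (punchOut 0≢k))

length-permutations : ∀ n → length (permutations n) ≡ n !
length-permutations zero    = refl
length-permutations (suc n) =
  trans (length-cartesianProductWith (insert zero) (allFin (suc n)) (permutations n))
        (cong₂ ℕ._*_ (length-tabulate {n = suc n} (λ i → i)) (length-permutations n))

permutations-complete : ∀ {n} (σ : Permutation′ n) → Any (σ ≈_) (permutations n)
permutations-complete {zero}  σ = here λ ()
permutations-complete {suc n} σ =
  cartesianProductWith⁺ (insert zero)
    (λ { {j} {π} refl σ′≈π k →
         trans (sym (insert-remove zero σ k)) (insert-cong j {remove zero σ} {π} σ′≈π k) })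
    (∈-allFin (σ ⟨$⟩ʳ zero)) (permutations-complete (remove zero σ))

-- The probability of an event for a uniformly random permutation.
ℙ : ∀ {n} {A : Pred (Permutation′ n) 0ℓ} → Decidable A → ℚ
ℙ {n} A? = (+ length (filter A? (permutations n)) / length (permutations n))
             {{subst NonZero (sym (length-permutations n)) (n ℕ.!≢0)}}

-- Empty when b < a.
∑[_⋯_] : ℕ → ℕ → (ℕ → ℚ) → ℚ
∑[ a ⋯ b ] f = foldr ℚ._+_ 0ℚ (applyUpTo (λ i → f (a ℕ.+ i)) (suc b ∸ a))

-- {σ(1), …, σ(t)}, where σ(i) is the image of the i-th element of Fin n.
called : ∀ {n} → Permutation′ n → ℕ → Subset n
called {n} σ t = ⋃ (map (λ i → ⁅ σ ⟨$⟩ʳ i ⁆) (take t (allFin n)))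

module _ {n} (M : Matroid n) where

  Independent : Pred (Subset n) 0ℓ
  Independent S = ¬ ∃ λ D → Circuit M D × D ⊆ S

  independent? : Decidable Independent
  independent? S = ¬? (anySubset? λ D → circuit? M D ×-dec D ⊆? S)

  rank : ℕ
  rank = max 0 (map ∣_∣ (filter independent? (subsets n)))

  IsUniqueCircuitIn : Subset n → Subset n → Set
  IsUniqueCircuitIn C X = Circuit M C × C ⊆ X × (∀ D → Circuit M D → D ⊆ X → D ≡ C)

  isUniqueCircuitIn? : ∀ C X → Dec (IsUniqueCircuitIn C X)
  isUniqueCircuitIn? C X = circuit? M C ×-dec C ⊆? X ×-dec
    map′ (λ ∄D D D∈𝓒 D⊆X → decidable-stable (≡-dec _≟ᵇ_ D C) λ D≢C → ∄D (D , D∈𝓒 , (λ {_} → D⊆X) , D≢C))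
         (λ { unique (D , D∈𝓒 , D⊆X , D≢C) → D≢C (unique D D∈𝓒 D⊆X) })
         (¬? (anySubset? λ D → circuit? M D ×-dec D ⊆? X ×-dec ¬? (≡-dec _≟ᵇ_ D C)))

  In𝓘 : Subset n → ℕ → Pred (Subset n) 0ℓ
  In𝓘 C k S = ∣ S ∣ ≡ k × S ⊆ ∁ C × IsUniqueCircuitIn C (S ∪ C)

  in𝓘? : ∀ C k → Decidable (In𝓘 C k)
  in𝓘? C k S = ∣ S ∣ ℕ.≟ k ×-dec S ⊆? ∁ C ×-dec isUniqueCircuitIn? C (S ∪ C)

  𝓘 : Subset n → ℕ → List (Subset n)
  𝓘 C k = filter (in𝓘? C k) (subsets n)

  WinsInRound : Subset n → ℕ → Pred (Permutation′ n) 0ℓ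
  WinsInRound C t σ = C ⊆ called σ t × Independent (called σ (t ∸ 1))

  winsInRound? : ∀ C t → Decidable (WinsInRound C t)
  winsInRound? C t σ = C ⊆? called σ t ×-dec independent? (called σ (t ∸ 1))

  Wins : Subset n → Pred (Permutation′ n) 0ℓ
  Wins C σ = ∃ λ (i : Fin n) → WinsInRound C (suc (toℕ i)) σ

  wins? : ∀ C → Decidable (Wins C)
  wins? C σ = any? λ i → winsInRound? C (suc (toℕ i)) σ

  βᵣ : Subset n → ℕ → ℚ
  βᵣ C t = ℙ (winsInRound? C t)

  β : Subset n → ℚ
  β C = ℙ (wins? C)

choose-nonZero : ∀ {n k} → k ≤ n → NonZero (n choose k)
choose-nonZero {n} {k} k≤n = ℕ.>-nonZero (subst (0 <_) (sym (nCk≡n!/k![n-k]! k≤n))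
  (m≥n⇒m/n>0 (∣⇒≤ (subst (_∣ n !) (ℕ.*-comm ((n ∸ k) !) (k !)) ([n∸k]!k!∣n! k≤n)))))
  where instance
    _ = n ℕ.!≢0
    _ = k ℕ.!* (n ∸ k) !≢0

ground-nonZero : ∀ {n} (M : Matroid n) {C} → Circuit M C → NonZero n
ground-nonZero {zero}  M {[]} C∈𝓒 = contradiction C∈𝓒 (∅-nonCircuit M)
ground-nonZero {suc n} M      C∈𝓒 = _

rank<n : ∀ {n} (M : Matroid n) {C} → Circuit M C → rank M < n
rank<n {n} M {C} C∈𝓒 =
  max<v⁺ (ℕ.>-nonZero⁻¹ n {{ground-nonZero M C∈𝓒}})
         (All.map⁺ (All.map ∣I∣<n (all-filter (independent? M) (subsets n))))
  where
  ∣I∣<n : ∀ {I} → Independent M I → ∣ I ∣ < n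
  ∣I∣<n {I} indep = ℕ.≤∧≢⇒< (∣p∣≤n I) λ ∣I∣≡n →
    indep (C , C∈𝓒 , subst (C ⊆_) (sym (∣p∣≡n⇒p≡⊤ ∣I∣≡n)) ⊆⊤)

round-choose-nonZero : ∀ {n} (M : Matroid n) {C} → Circuit M C →
                       ∀ {t} → t ≤ rank M ℕ.+ 1 → NonZero ((n ∸ 1) choose (t ∸ 1))
round-choose-nonZero M C∈𝓒 {t} t≤r+1 = choose-nonZero (ℕ.∸-monoˡ-≤ 1
  (ℕ.≤-trans (subst (t ≤_) (ℕ.+-comm (rank M) 1) t≤r+1) (rank<n M C∈𝓒)))

{-# OPTIONS --safe #-}

-- C wins in round t exactly when, for X the set of the first t elements called, C is the unique
-- circuit in X and the t-th element called lies in C.  Writing X = S ∪ C with S disjoint from C,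
-- the pairs (S , e), with e the t-th element, range over 𝓘_{C,t-|C|} × C, and each pair is realised
-- by (t-1)! (n-t)! permutations; dividing by n! gives the formula.  The rounds are disjoint events,
-- impossible for t < |C| by size and for t > r(M) + 1 because the first t - 1 elements are independent.

module Submission where

open import Defs
open import Data.Bool.Base using (true; false)
import Data.Bool.Properties as Bool
open import Data.Fin.Base using (Fin; zero; suc; toℕ; fromℕ<; punchIn; punchOut)
open import Data.Fin.Permutation
  using (Permutation′; _⟨$⟩ʳ_; _⟨$⟩ˡ_; insert; inverseˡ; inverseʳ)
open import Data.Fin.Properties as Fin
  using (toℕ<n; toℕ-fromℕ<; toℕ-injective; punchInᵢ≢i; punchIn-injective; punchIn-punchOut; punchOut-punchIn)
open import Data.Fin.Subset
  using (Subset; ∣_∣; inside; outside; _∈_; _∉_; _⊆_; _∪_; _∩_; _-_; ∁; ⋃; ⁅_⁆)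
open import Data.Fin.Subset.Properties
open import Data.Integer.Base as ℤ using (+_)
import Data.Integer.Properties as ℤ
open import Data.List.Base
  using (List; []; _∷_; map; filter; foldr; length; tabulate; allFin; applyUpTo; take;
         cartesianProduct; cartesianProductWith)
open import Data.List.Extrema.Nat using (xs≤max)
import Data.List.Membership.Propositional as List
open import Data.List.Membership.Propositional using (find; lose)
open import Data.List.Membership.Propositional.Properties
open import Data.List.Properties
  using (length-map; length-++; map-applyUpTo; filter-++; filter-none; filter-all)
open import Data.List.Relation.Unary.All as All using (All; []; _∷_)
open import Data.List.Relation.Unary.All.Properties using (All¬⇒¬Any)
open import Data.List.Relation.Unary.AllPairs as AllPairs using (AllPairs; []; _∷_)
import Data.List.Relation.Unary.AllPairs.Properties as AllPairs
open import Data.List.Relation.Unary.Any as Any using (Any; here)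
import Data.List.Relation.Unary.Any.Properties as Any
open import Data.List.Relation.Unary.Unique.Propositional using (Unique)
import Data.List.Relation.Unary.Unique.Propositional.Properties as Unique
open import Data.Nat.Base as ℕ
  using (ℕ; zero; suc; _+_; _∸_; _!; _≤_; _<_; z≤n; s≤s; s≤s⁻¹; NonZero)
open import Data.Nat.Combinatorics using (k![n∸k]!∣n!; nCk≡n!/k![n-k]!)
open import Data.Nat.DivMod using (m/n*n≡m)
open import Data.Nat.ListAction using (sum)
import Data.Nat.Properties as ℕ
open import Data.Nat.Tactic.RingSolver using (solve-∀)
open import Data.Product.Base using (∃; _×_; _,_; proj₁; proj₂)
open import Data.Rational.Base as ℚ using (0ℚ; _/_; _*_; toℚᵘ; fromℚᵘ)
import Data.Rational.Properties as ℚ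
open import Data.Rational.Unnormalised.Base as ℚᵘ using (mkℚᵘ; *≡*)
import Data.Rational.Unnormalised.Properties as ℚᵘ
open import Data.Sum.Base using (_⊎_; inj₁; inj₂; [_,_]′)
open import Data.Vec.Base as Vec using ([]; _∷_; removeAt; lookup)
open import Data.Vec.Properties using (removeAt-punchOut; []=⇒lookup; lookup⇒[]=; ∷-injectiveʳ; ≡-dec)
open import Function.Base using (_∘_; case_of_)
open import Function.Bundles using (_⇔_; mk⇔; Equivalence)
open import Relation.Binary.PropositionalEquality
open import Relation.Nullary.Decidable using (yes; no; does; _×-dec_)
open import Relation.Nullary.Negation using (¬_; contradiction)
open import Relation.Unary using (Decidable)

open Equivalence using (to; from)

private
  variable
    A B : Set
    n : ℕ

-- Counting list entries that satisfy a predicate.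

count : {A : Set} {P : A → Set} → Decidable P → List A → ℕ
count P? xs = length (filter P? xs)

count-none : ∀ {P : A → Set} (P? : Decidable P) → (∀ x → ¬ P x) → ∀ xs → count P? xs ≡ 0
count-none P? ¬P xs = cong length (filter-none P? (All.universal ¬P xs))

count-all : ∀ {P : A → Set} (P? : Decidable P) → (∀ x → P x) → ∀ xs → count P? xs ≡ length xs
count-all P? P xs = cong length (filter-all P? (All.universal P xs))

count-⊎ : ∀ {P Q R : A → Set} (P? : Decidable P) (Q? : Decidable Q) (R? : Decidable R) →
          (∀ x → P x ⇔ (Q x ⊎ R x)) → (∀ x → Q x → ¬ R x) →
          ∀ xs → count P? xs ≡ count Q? xs + count R? xs
count-⊎ P? Q? R? P⇔ Q#R []       = refl
count-⊎ P? Q? R? P⇔ Q#R (x ∷ xs) with P? x | Q? x | R? x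
... | _      | yes q | yes r = contradiction r (Q#R x q)
... | yes p  | yes q | no ¬r = cong suc (count-⊎ P? Q? R? P⇔ Q#R xs)
... | yes p  | no ¬q | yes r =
  trans (cong suc (count-⊎ P? Q? R? P⇔ Q#R xs)) (sym (ℕ.+-suc _ _))
... | yes p  | no ¬q | no ¬r = contradiction (to (P⇔ x) p) [ ¬q , ¬r ]′
... | no  ¬p | yes q | no _  = contradiction (from (P⇔ x) (inj₁ q)) ¬p
... | no  ¬p | no _  | yes r = contradiction (from (P⇔ x) (inj₂ r)) ¬p
... | no  ¬p | no ¬q | no ¬r = count-⊎ P? Q? R? P⇔ Q#R xs

-- Induction on the index list: the events of all later indices are merged into the single event
-- `rest?`, which pairwise disjointness separates from the event of the head, so `count-⊎` applies.
count-partition : ∀ {I : Set} {P : A → Set} {R : I → A → Set}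
                  (P? : Decidable P) (R? : ∀ i → Decidable (R i)) (is : List I) →
                  (∀ x → P x ⇔ Any (λ i → R i x) is) →
                  AllPairs (λ i j → ∀ x → R i x → ¬ R j x) is →
                  ∀ xs → count P? xs ≡ sum (map (λ i → count (R? i) xs) is)
count-partition P? R? []       P⇔ []            xs = count-none P? (λ x p → case to (P⇔ x) p of λ ()) xs
count-partition {R = R} P? R? (i ∷ is) P⇔ (i#is ∷ is#is) xs =
  trans (count-⊎ P? (R? i) rest? (λ x → mk⇔ (Any.toSum ∘ to (P⇔ x)) (from (P⇔ x) ∘ Any.fromSum))
           (λ x → All¬⇒¬Any ∘ λ r → All.map (λ i#j → i#j x r) i#is) xs)
        (cong (count (R? i) xs ℕ.+_)
              (count-partition rest? R? is (λ x → mk⇔ (λ r → r) (λ r → r)) is#is xs))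
  where
  rest? : Decidable (λ x → Any (λ j → R j x) is)
  rest? x = Any.any? (λ j → R? j x) is

count-map : ∀ {P : B → Set} (P? : Decidable P) (f : A → B) xs →
            count P? (map f xs) ≡ count (P? ∘ f) xs
count-map P? f []       = refl
count-map P? f (x ∷ xs) with does (P? (f x))
... | true  = cong suc (count-map P? f xs)
... | false = count-map P? f xs

-- Each `x` contributes a fibre of size `c` or an empty one, as `T` decides. With `f` equal to
-- `insert zero`, `x` is the element called first.
count-cartesianProductWith :
  ∀ {C : Set} {P : C → Set} {T : A → Set} (P? : Decidable P) (T? : Decidable T) (f : A → B → C) {c} ys →
  (∀ {x} → T x → count (P? ∘ f x) ys ≡ c) → (∀ {x} → ¬ T x → count (P? ∘ f x) ys ≡ 0) →
  ∀ xs → count P? (cartesianProductWith f xs ys) ≡ count T? xs ℕ.* c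
count-cartesianProductWith P? T? f ys fibre empty []       = refl
count-cartesianProductWith P? T? f {c} ys fibre empty (x ∷ xs) =
  trans (cong length (filter-++ P? (map (f x) ys) _))
    (trans (length-++ (filter P? (map (f x) ys)))
      (trans (cong₂ _+_ (count-map P? (f x) ys)
                        (count-cartesianProductWith P? T? f ys fibre empty xs)) split))
  where
  split : count (P? ∘ f x) ys + count T? xs ℕ.* c ≡ count T? (x ∷ xs) ℕ.* c
  split with T? x
  ... | yes t = cong (_+ _) (fibre t)
  ... | no ¬t = cong (_+ _) (empty ¬t)

-- Stated for an arbitrary `f` because the induction passes from `f` to `f ∘ suc`; only the identity
-- is needed later.
count-tabulate : ∀ {P : A → Set} (P? : Decidable P) (f : Fin n → A) (X : Subset n) →
                 (∀ i → P (f i) ⇔ i ∈ X) → count P? (tabulate f) ≡ ∣ X ∣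
count-tabulate P? f []      P⇔ = refl
count-tabulate P? f (x ∷ X) P⇔ with P? (f zero) | x
... | yes p | inside  = cong suc (count-tabulate P? (f ∘ suc) X tail)
  where tail = λ i → mk⇔ (drop-there ∘ to (P⇔ (suc i))) (from (P⇔ (suc i)) ∘ Vec.there)
... | no ¬p | outside = count-tabulate P? (f ∘ suc) X tail
  where tail = λ i → mk⇔ (drop-there ∘ to (P⇔ (suc i))) (from (P⇔ (suc i)) ∘ Vec.there)
... | yes p | outside = contradiction (to (P⇔ zero) p) λ ()
... | no ¬p | inside  = contradiction (from (P⇔ zero) Vec.here) ¬p

count-∈ : (X : Subset n) → count (_∈? X) (allFin n) ≡ ∣ X ∣
count-∈ X = count-tabulate (_∈? X) (λ i → i) X (λ i → mk⇔ (λ x → x) (λ x → x))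

-- Cardinalities, differences and deletions of finite subsets.

∣p∪q∣≡∣p∣+∣q∣ : (p q : Subset n) → (∀ {x} → x ∈ p → x ∉ q) → ∣ p ∪ q ∣ ≡ ∣ p ∣ + ∣ q ∣
∣p∪q∣≡∣p∣+∣q∣ []            []            p#q = refl
∣p∪q∣≡∣p∣+∣q∣ (inside  ∷ p) (inside  ∷ q) p#q = contradiction Vec.here (p#q Vec.here)
∣p∪q∣≡∣p∣+∣q∣ (inside  ∷ p) (outside ∷ q) p#q =
  cong suc (∣p∪q∣≡∣p∣+∣q∣ p q (λ x∈p x∈q → p#q (Vec.there x∈p) (Vec.there x∈q)))
∣p∪q∣≡∣p∣+∣q∣ (outside ∷ p) (inside  ∷ q) p#q =
  trans (cong suc (∣p∪q∣≡∣p∣+∣q∣ p q (λ x∈p x∈q → p#q (Vec.there x∈p) (Vec.there x∈q))))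
        (sym (ℕ.+-suc _ _))
∣p∪q∣≡∣p∣+∣q∣ (outside ∷ p) (outside ∷ q) p#q =
  ∣p∪q∣≡∣p∣+∣q∣ p q (λ x∈p x∈q → p#q (Vec.there x∈p) (Vec.there x∈q))

[p∩∁q]∪q≡p : {p q : Subset n} → q ⊆ p → (p ∩ ∁ q) ∪ q ≡ p
[p∩∁q]∪q≡p {p = p} {q} q⊆p = ⊆-antisym ⊆p p⊆
  where
  ⊆p : (p ∩ ∁ q) ∪ q ⊆ p
  ⊆p x∈ with x∈p∪q⁻ (p ∩ ∁ q) q x∈
  ... | inj₁ x∈p∩∁q = proj₁ (x∈p∩q⁻ p (∁ q) x∈p∩∁q)
  ... | inj₂ x∈q    = q⊆p x∈q
  p⊆ : p ⊆ (p ∩ ∁ q) ∪ q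
  p⊆ {x} x∈p with x ∈? q
  ... | yes x∈q = x∈p∪q⁺ (inj₂ x∈q)
  ... | no  x∉q = x∈p∪q⁺ (inj₁ (x∈p∩q⁺ (x∈p , x∉p⇒x∈∁p x∉q)))

[p∪q]∩∁q≡p : {p q : Subset n} → p ⊆ ∁ q → (p ∪ q) ∩ ∁ q ≡ p
[p∪q]∩∁q≡p {p = p} {q} p⊆∁q = ⊆-antisym ⊆p λ x∈p → x∈p∩q⁺ (p⊆p∪q q x∈p , p⊆∁q x∈p)
  where
  ⊆p : (p ∪ q) ∩ ∁ q ⊆ p
  ⊆p x∈ with x∈p∪q , x∈∁q ← x∈p∩q⁻ (p ∪ q) (∁ q) x∈ with x∈p∪q⁻ p q x∈p∪q
  ... | inj₁ x∈p = x∈p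
  ... | inj₂ x∈q = contradiction x∈q (x∈∁p⇒x∉p x∈∁q)

x∉p-x : (p : Subset n) (x : Fin n) → x ∉ p - x
x∉p-x (_ ∷ p) zero    ()
x∉p-x (_ ∷ p) (suc x) (Vec.there x∈) = x∉p-x p x x∈

1+∣p-x∣≡∣p∣ : ∀ {p : Subset n} {x} → x ∈ p → suc ∣ p - x ∣ ≡ ∣ p ∣
1+∣p-x∣≡∣p∣ {p = p} {x} x∈p = begin
  suc ∣ p - x ∣           ≡⟨ ℕ.+-comm 1 _ ⟩
  ∣ p - x ∣ + 1           ≡⟨ cong (∣ p - x ∣ ℕ.+_) (∣⁅x⁆∣≡1 x) ⟨
  ∣ p - x ∣ + ∣ ⁅ x ⁆ ∣   ≡⟨ ∣p∪q∣≡∣p∣+∣q∣ (p - x) ⁅ x ⁆ disjoint ⟨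
  ∣ (p - x) ∪ ⁅ x ⁆ ∣     ≡⟨ cong ∣_∣ (⊆-antisym ⊆p p⊆) ⟩
  ∣ p ∣                   ∎
  where
  open ≡-Reasoning
  disjoint : ∀ {y} → y ∈ p - x → y ∉ ⁅ x ⁆
  disjoint y∈p-x y∈⁅x⁆ = x∉p-x p x (subst (_∈ p - x) (x∈⁅y⁆⇒x≡y x y∈⁅x⁆) y∈p-x)
  ⊆p : (p - x) ∪ ⁅ x ⁆ ⊆ p
  ⊆p y∈ with x∈p∪q⁻ (p - x) ⁅ x ⁆ y∈
  ... | inj₁ y∈p-x = p─q⊆p p ⁅ x ⁆ y∈p-x
  ... | inj₂ y∈⁅x⁆ rewrite x∈⁅y⁆⇒x≡y x y∈⁅x⁆ = x∈p
  p⊆ : p ⊆ (p - x) ∪ ⁅ x ⁆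
  p⊆ {y} y∈p with y Fin.≟ x
  ... | yes refl = x∈p∪q⁺ (inj₂ (x∈⁅x⁆ x))
  ... | no  y≢x  = x∈p∪q⁺ (inj₁ (x∈p∧x≢y⇒x∈p-y y∈p y≢x))

-- Deleting a coordinate relabels the others through `punchIn x`, the same relabelling that `insert`
-- applies to the values of a permutation.
∈-removeAt : (p : Subset (suc n)) (x : Fin (suc n)) (y : Fin n) → y ∈ removeAt p x ⇔ punchIn x y ∈ p
∈-removeAt p x y = mk⇔
  (λ y∈ → lookup⇒[]= _ p (trans (sym eq) ([]=⇒lookup y∈)))
  (λ y∈ → lookup⇒[]= _ (removeAt p x) (trans eq ([]=⇒lookup y∈)))
  where
  eq : lookup (removeAt p x) y ≡ lookup p (punchIn x y)
  eq = trans (cong (lookup (removeAt p x)) (sym (punchOut-punchIn x)))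
             (removeAt-punchOut p (punchInᵢ≢i x y ∘ sym))

1+∣removeAt∣≡∣p∣ : (p : Subset (suc n)) {x : Fin (suc n)} → x ∈ p → suc ∣ removeAt p x ∣ ≡ ∣ p ∣
1+∣removeAt∣≡∣p∣ (inside  ∷ p)         Vec.here         = refl
1+∣removeAt∣≡∣p∣ (inside  ∷ p@(_ ∷ _)) (Vec.there x∈p) = cong suc (1+∣removeAt∣≡∣p∣ p x∈p)
1+∣removeAt∣≡∣p∣ (outside ∷ p@(_ ∷ _)) (Vec.there x∈p) = 1+∣removeAt∣≡∣p∣ p x∈p

-- Permutations with a prescribed initial set and a prescribed last element of it.

⟨$⟩ʳ-injective : (σ : Permutation′ n) → ∀ {i j} → σ ⟨$⟩ʳ i ≡ σ ⟨$⟩ʳ j → i ≡ j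
⟨$⟩ʳ-injective σ {i} {j} eq =
  trans (sym (inverseˡ σ)) (trans (cong (σ ⟨$⟩ˡ_) eq) (inverseˡ σ))

-- Positions start at zero, so `i` stands for round `suc (toℕ i)`. The initial set is described
-- position by position rather than through `called`, which lets the condition be restricted to the
-- positions after the first.
Arranges : Fin n → Subset n → Fin n → Permutation′ n → Set
Arranges i X e σ = (∀ j → toℕ j ≤ toℕ i ⇔ σ ⟨$⟩ʳ j ∈ X) × σ ⟨$⟩ʳ i ≡ e

-- `insert zero j π` calls `j` first and then follows `π` with values shifted by `punchIn j`.
-- Dropping the first call therefore removes `j` from the initial set and relabels `e` by
-- `punchOut`.
arranges-insert : ∀ {i : Fin n} {X : Subset (suc n)} {j e} → j ∈ X → (j≢e : j ≢ e) → ∀ π →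
                  Arranges (suc i) X e (insert zero j π) ⇔ Arranges i (removeAt X j) (punchOut j≢e) π
arranges-insert {n} {i} {X} {j} {e} j∈X j≢e π = mk⇔
  (λ (pre , last) →
    (λ k → mk⇔ (λ k≤i → from (∈-removeAt X j _) (to (pre (suc k)) (s≤s k≤i)))
               (λ πk∈ → s≤s⁻¹ (from (pre (suc k)) (to (∈-removeAt X j _) πk∈)))) ,
    punchIn-injective j _ _ (trans last (sym (punchIn-punchOut j≢e))))
  (λ (pre , last) →
    (λ { zero    → mk⇔ (λ _ → j∈X) (λ _ → z≤n)
       ; (suc k) → mk⇔ (λ k≤i → to (∈-removeAt X j _) (to (pre k) (s≤s⁻¹ k≤i)))
                       (λ σk∈ → s≤s (from (pre k) (from (∈-removeAt X j _) σk∈))) }) ,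
    trans (cong (punchIn j) last) (punchIn-punchOut j≢e))

arranges-zero : ∀ {X : Subset (suc n)} {e} → ∣ X ∣ ≡ 1 → e ∈ X → ∀ π → Arranges zero X e (insert zero e π)
arranges-zero {X = X} {e} ∣X∣≡1 e∈X π =
  (λ { zero    → mk⇔ (λ _ → e∈X) (λ _ → z≤n)
     ; (suc k) → mk⇔ (λ ()) (λ x∈X → contradiction x∈X (only-e (punchInᵢ≢i e _))) }) , refl
  where
  only-e : ∀ {x} → x ≢ e → x ∉ X
  -- A second element of `X` would remain in `X - e`, which has size zero.
  only-e x≢e x∈X = ℕ.<⇒≱ (s≤s z≤n)
    (subst (_≤ 0) (sym (1+∣p-x∣≡∣p∣ (x∈p∧x≢y⇒x∈p-y x∈X x≢e)))
       (ℕ.≤-reflexive (ℕ.suc-injective (trans (1+∣p-x∣≡∣p∣ e∈X) ∣X∣≡1))))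

-- By recursion on i, deleting the element called first: it may be any element of X other than e,
-- or must be e when i = 0.
count-arrangements :
  ∀ {n} (i : Fin n) (X : Subset n) (e : Fin n) → ∣ X ∣ ≡ suc (toℕ i) → e ∈ X →
  ∀ {P : Permutation′ n → Set} (P? : Decidable P) → (∀ σ → P σ ⇔ Arranges i X e σ) →
  count P? (permutations n) ≡ toℕ i ! ℕ.* (n ∸ suc (toℕ i)) !
count-arrangements {suc n} zero X e ∣X∣≡1 e∈X P? P⇔ = begin
  count P? (permutations (suc n))
    ≡⟨ count-cartesianProductWith P? (_∈? ⁅ e ⁆) (insert zero) (permutations n) fibre empty (allFin (suc n)) ⟩
  count (_∈? ⁅ e ⁆) (allFin (suc n)) ℕ.* n !
    ≡⟨ cong (ℕ._* n !) (trans (count-∈ ⁅ e ⁆) (∣⁅x⁆∣≡1 e)) ⟩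
  1 ℕ.* n !
    ∎
  where
  open ≡-Reasoning
  fibre : ∀ {j} → j ∈ ⁅ e ⁆ → count (P? ∘ insert zero j) (permutations n) ≡ n !
  fibre j∈ rewrite x∈⁅y⁆⇒x≡y e j∈ =
    trans (count-all (P? ∘ insert zero e)
             (λ π → from (P⇔ (insert zero e π)) (arranges-zero ∣X∣≡1 e∈X π)) (permutations n))
          (length-permutations n)
  empty : ∀ {j} → j ∉ ⁅ e ⁆ → count (P? ∘ insert zero j) (permutations n) ≡ 0
  empty {j} j∉ = count-none (P? ∘ insert zero j)
    (λ π Pσ → x∉⁅y⁆⇒x≢y j∉ (proj₂ (to (P⇔ (insert zero j π)) Pσ))) (permutations n)
count-arrangements {suc n} (suc i) X e ∣X∣≡2+i e∈X P? P⇔ = begin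
  count P? (permutations (suc n))
    ≡⟨ count-cartesianProductWith P? (_∈? (X - e)) (insert zero) (permutations n) fibre empty (allFin (suc n)) ⟩
  count (_∈? (X - e)) (allFin (suc n)) ℕ.* c
    ≡⟨ cong (ℕ._* c) (trans (count-∈ (X - e)) ∣X-e∣≡1+i) ⟩
  suc (toℕ i) ℕ.* (toℕ i ! ℕ.* (n ∸ suc (toℕ i)) !)
    ≡⟨ ℕ.*-assoc (suc (toℕ i)) (toℕ i !) _ ⟨
  suc (toℕ i) ! ℕ.* (n ∸ suc (toℕ i)) !
    ∎
  where
  open ≡-Reasoning
  c = toℕ i ! ℕ.* (n ∸ suc (toℕ i)) !
  ∣X-e∣≡1+i : ∣ X - e ∣ ≡ suc (toℕ i)
  ∣X-e∣≡1+i = ℕ.suc-injective (trans (1+∣p-x∣≡∣p∣ e∈X) ∣X∣≡2+i)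
  fibre : ∀ {j} → j ∈ X - e → count (P? ∘ insert zero j) (permutations n) ≡ c
  fibre {j} j∈ = count-arrangements i (removeAt X j) (punchOut j≢e)
    (ℕ.suc-injective (trans (1+∣removeAt∣≡∣p∣ X j∈X) ∣X∣≡2+i))
    (from (∈-removeAt X j _) (subst (_∈ X) (sym (punchIn-punchOut j≢e)) e∈X))
    (P? ∘ insert zero j)
    (λ π → mk⇔ (to (arranges-insert j∈X j≢e π) ∘ to (P⇔ (insert zero j π)))
               (from (P⇔ (insert zero j π)) ∘ from (arranges-insert j∈X j≢e π)))
    where
    j∈X : j ∈ X
    j∈X = p─q⊆p X ⁅ e ⁆ j∈
    j≢e : j ≢ e
    j≢e refl = x∉p-x X e j∈
  empty : ∀ {j} → j ∉ X - e → count (P? ∘ insert zero j) (permutations n) ≡ 0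
  empty {j} j∉ = count-none (P? ∘ insert zero j) none (permutations n)
    where
    none : ∀ π → ¬ _
    none π Pσ with to (P⇔ (insert zero j π)) Pσ
    ... | pre , last = j∉ (x∈p∧x≢y⇒x∈p-y (to (pre zero) z≤n)
                             (λ { refl → punchInᵢ≢i j _ last }))

-- Arithmetic of rational fractions.

/-cross : ∀ a b c d .{{_ : NonZero b}} .{{_ : NonZero d}} → a ℕ.* d ≡ c ℕ.* b → + a / b ≡ + c / d
-- Once the denominators are visibly successors, `/` is `fromℚᵘ` of an unnormalised fraction, and
-- equality there is cross-multiplication.
/-cross a b@(suc b-1) c d@(suc d-1) ad≡cb = ℚ.fromℚᵘ-cong {mkℚᵘ (+ a) b-1} {mkℚᵘ (+ c) d-1}
  (*≡* (trans (sym (ℤ.pos-* a d)) (trans (cong +_ ad≡cb) (ℤ.pos-* c b))))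

-- Inherited from `toℚᵘ`, which is injective, respects products and undoes `fromℚᵘ` up to
-- equivalence of fractions.
fromℚᵘ-homo-* : ∀ p q → fromℚᵘ (p ℚᵘ.* q) ≡ fromℚᵘ p * fromℚᵘ q
fromℚᵘ-homo-* p q = ℚ.toℚᵘ-injective (begin
  toℚᵘ (fromℚᵘ (p ℚᵘ.* q))                    ≈⟨ ℚ.toℚᵘ-fromℚᵘ _ ⟩
  p ℚᵘ.* q                                    ≈⟨ ℚᵘ.*-cong (ℚ.toℚᵘ-fromℚᵘ p) (ℚ.toℚᵘ-fromℚᵘ q) ⟨
  toℚᵘ (fromℚᵘ p) ℚᵘ.* toℚᵘ (fromℚᵘ q)        ≈⟨ ℚ.toℚᵘ-homo-* (fromℚᵘ p) (fromℚᵘ q) ⟨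
  toℚᵘ (fromℚᵘ p * fromℚᵘ q)                  ∎)
  where open ℚᵘ.≃-Reasoning

fromℚᵘ-homo-+ : ∀ p q → fromℚᵘ (p ℚᵘ.+ q) ≡ fromℚᵘ p ℚ.+ fromℚᵘ q
fromℚᵘ-homo-+ p q = ℚ.toℚᵘ-injective (begin
  toℚᵘ (fromℚᵘ (p ℚᵘ.+ q))                    ≈⟨ ℚ.toℚᵘ-fromℚᵘ _ ⟩
  p ℚᵘ.+ q                                    ≈⟨ ℚᵘ.+-cong (ℚ.toℚᵘ-fromℚᵘ p) (ℚ.toℚᵘ-fromℚᵘ q) ⟨
  toℚᵘ (fromℚᵘ p) ℚᵘ.+ toℚᵘ (fromℚᵘ q)        ≈⟨ ℚ.toℚᵘ-homo-+ (fromℚᵘ p) (fromℚᵘ q) ⟨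
  toℚᵘ (fromℚᵘ p ℚ.+ fromℚᵘ q)                ∎)
  where open ℚᵘ.≃-Reasoning

/-*-/ : ∀ a b c d .{{_ : NonZero b}} .{{_ : NonZero d}} →
        (+ a / b) * (+ c / d) ≡ (+ (a ℕ.* c) / (b ℕ.* d)) {{ℕ.m*n≢0 b d}}
/-*-/ a b@(suc b-1) c d@(suc d-1) =
  trans (sym (fromℚᵘ-homo-* (mkℚᵘ (+ a) b-1) (mkℚᵘ (+ c) d-1))) (cong (_/ (b ℕ.* d)) (sym (ℤ.pos-* a c)))

/-+-/ : ∀ a b d .{{_ : NonZero d}} → (+ a / d) ℚ.+ (+ b / d) ≡ + (a + b) / d
/-+-/ a b d@(suc d-1) =
  trans (sym (fromℚᵘ-homo-+ (mkℚᵘ (+ a) d-1) (mkℚᵘ (+ b) d-1)))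
    (trans (cong (_/ (d ℕ.* d)) numerator)
      (/-cross (a ℕ.* d + b ℕ.* d) (d ℕ.* d) (a + b) d (eq a b d)))
  where
  numerator : (+ a) ℤ.* (+ d) ℤ.+ (+ b) ℤ.* (+ d) ≡ + (a ℕ.* d + b ℕ.* d)
  numerator = trans (cong₂ ℤ._+_ (sym (ℤ.pos-* a d)) (sym (ℤ.pos-* b d)))
                    (sym (ℤ.pos-+ (a ℕ.* d) (b ℕ.* d)))
  eq : ∀ a b d → (a ℕ.* d + b ℕ.* d) ℕ.* d ≡ (a + b) ℕ.* (d ℕ.* d)
  eq = solve-∀

-- All probabilities share the denominator `N`, the number of permutations, so a sum of
-- probabilities reduces to a sum of counts.
∑-/ : ∀ (g : ℕ → ℕ) N .{{_ : NonZero N}} m →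
      foldr ℚ._+_ 0ℚ (applyUpTo (λ i → + g i / N) m) ≡ + sum (applyUpTo g m) / N
∑-/ g N zero    = /-cross 0 1 0 N refl
∑-/ g N (suc m) = trans (cong (ℚ._+_ (+ g 0 / N)) (∑-/ (g ∘ suc) N m))
                        (/-+-/ (g 0) (sum (applyUpTo (g ∘ suc) m)) N)

-- Factorials and binomial coefficients.

nCk*k![n∸k]!≡n! : ∀ {n k} → k ≤ n → (n choose k) ℕ.* (k ! ℕ.* (n ∸ k) !) ≡ n !
nCk*k![n∸k]!≡n! {n} {k} k≤n =
  trans (cong (ℕ._* (k ! ℕ.* (n ∸ k) !)) (nCk≡n!/k![n-k]! k≤n)) (m/n*n≡m (k![n∸k]!∣n! k≤n))
  where instance _ = k ℕ.!* (n ∸ k) !≢0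

-- This identity turns the number of permutations per pair, divided by `n !`, into the reciprocal of
-- `n` times the binomial coefficient.
n*[n-1]Ci*i![n-1-i]!≡n! : (i : Fin n) →
  n ℕ.* (((n ∸ 1) choose toℕ i) ℕ.* (toℕ i ! ℕ.* (n ∸ suc (toℕ i)) !)) ≡ n !
n*[n-1]Ci*i![n-1-i]!≡n! {suc n} i = cong (suc n ℕ.*_) (nCk*k![n∸k]!≡n! (s≤s⁻¹ (toℕ<n i)))

-- The sets of elements called so far.

∈-⋃-take⁺ : ∀ {m} (g : A → Subset n) (f : Fin m → A) {t x i} → toℕ i < t → x ∈ g (f i) →
            x ∈ ⋃ (map g (take t (tabulate f)))
∈-⋃-take⁺ g f {suc t} {i = zero}  i<t x∈ = x∈p∪q⁺ (inj₁ x∈)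
∈-⋃-take⁺ g f {suc t} {i = suc i} i<t x∈ = x∈p∪q⁺ (inj₂ (∈-⋃-take⁺ g (f ∘ suc) (s≤s⁻¹ i<t) x∈))

∈-⋃-take⁻ : ∀ {m} (g : A → Subset n) (f : Fin m → A) t {x} → x ∈ ⋃ (map g (take t (tabulate f))) →
            ∃ λ i → toℕ i < t × x ∈ g (f i)
∈-⋃-take⁻             g f zero    x∈ = contradiction x∈ ∉⊥
∈-⋃-take⁻ {m = zero}  g f (suc t) x∈ = contradiction x∈ ∉⊥
∈-⋃-take⁻ {m = suc m} g f (suc t) x∈ with x∈p∪q⁻ (g (f zero)) _ x∈
... | inj₁ x∈₀ = zero , s≤s z≤n , x∈₀
... | inj₂ x∈⋃ with i , i<t , x∈ᵢ ← ∈-⋃-take⁻ g (f ∘ suc) t x∈⋃ = suc i , s≤s i<t , x∈ᵢ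

-- Membership in the union only says that `σ ⟨$⟩ʳ i` equals some `σ ⟨$⟩ʳ j` with `j` early enough;
-- injectivity of `σ` then gives `i ≡ j`.
∈-called : (σ : Permutation′ n) (t : ℕ) (i : Fin n) → σ ⟨$⟩ʳ i ∈ called σ t ⇔ toℕ i < t
∈-called σ t i = mk⇔ ⇒ (λ i<t → ∈-⋃-take⁺ (λ i → ⁅ σ ⟨$⟩ʳ i ⁆) (λ i → i) i<t (x∈⁅x⁆ _))
  where
  ⇒ : σ ⟨$⟩ʳ i ∈ called σ t → toℕ i < t
  ⇒ σi∈ with j , j<t , σi∈σj ← ∈-⋃-take⁻ (λ i → ⁅ σ ⟨$⟩ʳ i ⁆) (λ i → i) t σi∈ =
    subst (λ i → toℕ i < t) (sym (⟨$⟩ʳ-injective σ (x∈⁅y⁆⇒x≡y _ σi∈σj))) j<t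

-- Since `σ` is onto, an inclusion may be tested at positions, where membership in `called` is a
-- comparison of numbers.
⊆-along : (σ : Permutation′ n) {X Y : Subset n} → (∀ i → σ ⟨$⟩ʳ i ∈ X → σ ⟨$⟩ʳ i ∈ Y) → X ⊆ Y
⊆-along σ {X} {Y} X⇒Y {x} x∈X =
  subst (_∈ Y) (inverseʳ σ) (X⇒Y (σ ⟨$⟩ˡ x) (subst (_∈ X) (sym (inverseʳ σ)) x∈X))

called-mono : (σ : Permutation′ n) {s t : ℕ} → s ≤ t → called σ s ⊆ called σ t
called-mono σ s≤t = ⊆-along σ λ i i∈ → from (∈-called σ _ i) (ℕ.<-≤-trans (to (∈-called σ _ i) i∈) s≤t)

called-last : (σ : Permutation′ n) (i : Fin n) → called σ (suc (toℕ i)) - (σ ⟨$⟩ʳ i) ≡ called σ (toℕ i)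
called-last σ i = ⊆-antisym
  (⊆-along σ λ j j∈ → from (∈-called σ _ j)
    (ℕ.≤∧≢⇒< (s≤s⁻¹ (to (∈-called σ _ j) (p─q⊆p _ _ j∈)))
      λ j≡i → x∉p-x (called σ (suc (toℕ i))) _ (subst (λ j → σ ⟨$⟩ʳ j ∈ _) (toℕ-injective j≡i) j∈)))
  (⊆-along σ λ j j∈ → x∈p∧x≢y⇒x∈p-y (called-mono σ (ℕ.n≤1+n _) j∈)
    λ σj≡σi → ℕ.<⇒≢ (to (∈-called σ _ j) j∈) (cong toℕ (⟨$⟩ʳ-injective σ σj≡σi)))

∣called-suc∣ : (σ : Permutation′ n) (i : Fin n) → ∣ called σ (suc (toℕ i)) ∣ ≡ suc ∣ called σ (toℕ i) ∣
∣called-suc∣ σ i = trans (sym (1+∣p-x∣≡∣p∣ (from (∈-called σ _ i) ℕ.≤-refl)))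
                         (cong (suc ∘ ∣_∣) (called-last σ i))

∣called∣ : (σ : Permutation′ n) {t : ℕ} → t ≤ n → ∣ called σ t ∣ ≡ t
∣called∣ {n} σ {zero}  _   = ∣⊥∣≡0 n
∣called∣ {n} σ {suc t} t<n = trans
  (subst (λ s → ∣ called σ (suc s) ∣ ≡ suc ∣ called σ s ∣) (toℕ-fromℕ< t<n) (∣called-suc∣ σ (fromℕ< t<n)))
  (cong suc (∣called∣ σ (ℕ.<⇒≤ t<n)))

called-arranges : (σ : Permutation′ n) (i : Fin n) → Arranges i (called σ (suc (toℕ i))) (σ ⟨$⟩ʳ i) σ
called-arranges σ i = (λ j → mk⇔ (from (∈-called σ _ j) ∘ s≤s) (s≤s⁻¹ ∘ to (∈-called σ _ j))) , refl

-- With `called-arranges`, this identifies the `X` of `Arranges` with the set called by the end of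
-- round `suc (toℕ i)`.
arranges⇒called : {σ : Permutation′ n} {i : Fin n} {X : Subset n} {e : Fin n} →
                  Arranges i X e σ → called σ (suc (toℕ i)) ≡ X
arranges⇒called {σ = σ} (pre , _) = ⊆-antisym
  (⊆-along σ λ j j∈ → to (pre j) (s≤s⁻¹ (to (∈-called σ _ j) j∈)))
  (⊆-along σ λ j j∈ → from (∈-called σ _ j) (s≤s (from (pre j) j∈)))

-- Enumerating subsets and pairs.

∈-subsets : (S : Subset n) → S List.∈ subsets n
∈-subsets []            = here refl
∈-subsets (outside ∷ S) = ∈-++⁺ˡ (∈-map⁺ (outside ∷_) (∈-subsets S))
∈-subsets (inside  ∷ S) = ∈-++⁺ʳ _ (∈-map⁺ (inside ∷_) (∈-subsets S))

subsets-unique : ∀ n → Unique (subsets n)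
subsets-unique zero    = [] ∷ []
subsets-unique (suc n) = Unique.++⁺
  (Unique.map⁺ ∷-injectiveʳ (subsets-unique n)) (Unique.map⁺ ∷-injectiveʳ (subsets-unique n))
  λ (x∈ , x∈′) → case ∈-map⁻ (outside ∷_) x∈ , ∈-map⁻ (inside ∷_) x∈′ of
    λ { ((_ , _ , refl) , (_ , _ , ())) }

length-cartesianProduct : (xs : List A) (ys : List B) →
                          length (cartesianProduct xs ys) ≡ length xs ℕ.* length ys
length-cartesianProduct []       ys = refl
length-cartesianProduct (x ∷ xs) ys =
  trans (length-++ (map (x ,_) ys)) (cong₂ _+_ (length-map (x ,_) ys) (length-cartesianProduct xs ys))

sum-map-constant : (f : A → ℕ) {c : ℕ} {xs : List A} → All (λ x → f x ≡ c) xs →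
                   sum (map f xs) ≡ length xs ℕ.* c
sum-map-constant f []         = refl
sum-map-constant f (fx ∷ fxs) = cong₂ _+_ fx (sum-map-constant f fxs)

-- Circuits, independence and the rounds won by a circuit.

module _ (M : Matroid n) where

  ∣independent∣≤rank : ∀ {S} → Independent M S → ∣ S ∣ ≤ rank M
  ∣independent∣≤rank {S} ind =
    All.lookup (xs≤max 0 _) (∈-map⁺ ∣_∣ (∈-filter⁺ (independent? M) (∈-subsets S) ind))

  module _ {C : Subset n} (C∈𝓒 : Circuit M C) where

    ∣C∣>0 : 0 < ∣ C ∣
    ∣C∣>0 with nonempty? C
    ... | yes (x , x∈C) = subst (0 <_) (1+∣p-x∣≡∣p∣ x∈C) (s≤s z≤n)
    ... | no  ¬∃x       = contradiction (subst (Circuit M) (Empty-unique ¬∃x) C∈𝓒) (∅-nonCircuit M)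

    -- A second circuit in X would contain e too, and eliminating e would leave a circuit in X - e.
    unique-iff-independent : ∀ {X e} → C ⊆ X → e ∈ C → IsUniqueCircuitIn M C X ⇔ Independent M (X - e)
    unique-iff-independent {X} {e} C⊆X e∈C = mk⇔
      (λ (_ , _ , unique) (D , D∈𝓒 , D⊆X-e) →
        x∉p-x X e (D⊆X-e (subst (e ∈_) (sym (unique D D∈𝓒 (p─q⊆p X ⁅ e ⁆ ∘ D⊆X-e))) e∈C)))
      (λ ind → C∈𝓒 , (λ {_} → C⊆X) , unique ind)
      where
      avoids : ∀ {D} → D ⊆ X → e ∉ D → D ⊆ X - e
      avoids D⊆X e∉D x∈D = x∈p∧x≢y⇒x∈p-y (D⊆X x∈D) λ { refl → e∉D x∈D }
      unique : Independent M (X - e) → ∀ D → Circuit M D → D ⊆ X → D ≡ C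
      unique ind D D∈𝓒 D⊆X with ≡-dec Bool._≟_ D C | e ∈? D
      ... | yes D≡C | _       = D≡C
      ... | no  _   | no  e∉D = contradiction (D , D∈𝓒 , λ {_} → avoids D⊆X e∉D) ind
      ... | no  D≢C | yes e∈D with F , F∈𝓒 , F⊆ ← elimination M D∈𝓒 C∈𝓒 D≢C e∈D e∈C =
        contradiction (F , F∈𝓒 , λ {_} → avoids F⊆X λ e∈F → x∉p-x (D ∪ C) e (F⊆ e∈F)) ind
        where
        F⊆X : F ⊆ X
        F⊆X x∈F with x∈p∪q⁻ D C (p─q⊆p _ _ (F⊆ x∈F))
        ... | inj₁ x∈D = D⊆X x∈D
        ... | inj₂ x∈C = C⊆X x∈C

    -- If `C` wins, the element just called lies in `C`, since otherwise `C` would already be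
    -- contained in the independent set called before it. Removing that element gives the earlier
    -- set, so `unique-iff-independent` translates both ways.
    wins-iff-unique : ∀ i σ → WinsInRound M C (suc (toℕ i)) σ ⇔
                      (IsUniqueCircuitIn M C (called σ (suc (toℕ i))) × σ ⟨$⟩ʳ i ∈ C)
    wins-iff-unique i σ = mk⇔
      (λ (C⊆ , ind) → let e∈C = last∈C C⊆ ind in
        from (unique-iff-independent C⊆ e∈C) (subst (Independent M) (sym (called-last σ i)) ind) , e∈C)
      (λ { (unique@(_ , C⊆ , _) , e∈C) →
        C⊆ , subst (Independent M) (called-last σ i) (to (unique-iff-independent C⊆ e∈C) unique) })
      where
      last∈C : C ⊆ called σ (suc (toℕ i)) → Independent M (called σ (toℕ i)) → σ ⟨$⟩ʳ i ∈ C
      last∈C C⊆ ind with σ ⟨$⟩ʳ i ∈? C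
      ... | yes e∈C = e∈C
      ... | no  e∉C = contradiction
        (C , C∈𝓒 , λ {x} x∈C → subst (x ∈_) (called-last σ i)
          (x∈p∧x≢y⇒x∈p-y (C⊆ x∈C) λ { refl → e∉C x∈C })) ind

    -- The winning permutations are partitioned by the pair consisting of the called elements
    -- outside `C` and the last element called; all blocks have the same size.
    count-winning : ∀ (i : Fin n) → ∣ C ∣ ≤ suc (toℕ i) →
      count (winsInRound? M C (suc (toℕ i))) (permutations n) ≡
      length (𝓘 M C (suc (toℕ i) ∸ ∣ C ∣)) ℕ.* ∣ C ∣ ℕ.* (toℕ i ! ℕ.* (n ∸ suc (toℕ i)) !)
    count-winning i ∣C∣≤t = begin
      count (winsInRound? M C t) (permutations n)
        ≡⟨ count-partition (winsInRound? M C t) plays? pairs wins⇔ disjoint (permutations n) ⟩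
      sum (map (λ p → count (plays? p) (permutations n)) pairs)
        ≡⟨ sum-map-constant _ (All.tabulate count-plays) ⟩
      length pairs ℕ.* c
        ≡⟨ cong (ℕ._* c) (length-cartesianProduct (𝓘 M C k) elements) ⟩
      length (𝓘 M C k) ℕ.* length elements ℕ.* c
        ≡⟨ cong (λ m → length (𝓘 M C k) ℕ.* m ℕ.* c) (count-∈ C) ⟩
      length (𝓘 M C k) ℕ.* ∣ C ∣ ℕ.* c
        ∎
      where
      open ≡-Reasoning
      t k c : ℕ
      t = suc (toℕ i)
      k = t ∸ ∣ C ∣
      c = toℕ i ! ℕ.* (n ∸ t) !
      elements : List (Fin n)
      elements = filter (_∈? C) (allFin n)
      pairs : List (Subset n × Fin n)
      pairs = cartesianProduct (𝓘 M C k) elements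

      -- The inclusion of `C` makes `S` determine the called set as `S ∪ C`.
      Plays : Subset n × Fin n → Permutation′ n → Set
      Plays (S , e) σ = C ⊆ called σ t × called σ t ∩ ∁ C ≡ S × σ ⟨$⟩ʳ i ≡ e

      plays? : ∀ p → Decidable (Plays p)
      plays? (S , e) σ = C ⊆? called σ t ×-dec ≡-dec Bool._≟_ (called σ t ∩ ∁ C) S ×-dec σ ⟨$⟩ʳ i Fin.≟ e

      disjoint : AllPairs (λ p q → ∀ σ → Plays p σ → ¬ Plays q σ) pairs
      -- Both coordinates of the pair can be read off from `σ`, so two pairs played by the same `σ`
      -- coincide, while `pairs` has no repetitions.
      disjoint = AllPairs.map (λ { p≢q σ (_ , refl , refl) (_ , refl , refl) → p≢q refl })
        (Unique.cartesianProduct⁺ (Unique.filter⁺ (in𝓘? M C k) (subsets-unique n))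
                                  (Unique.filter⁺ (_∈? C) (Unique.allFin⁺ n)))

      ∣∪C∣ : ∀ {S} → S ⊆ ∁ C → ∣ S ∪ C ∣ ≡ ∣ S ∣ + ∣ C ∣
      ∣∪C∣ {S} S⊆∁C = ∣p∪q∣≡∣p∣+∣q∣ S C (x∈∁p⇒x∉p ∘ S⊆∁C)

      wins⇔ : ∀ σ → WinsInRound M C t σ ⇔ Any (λ p → Plays p σ) pairs
      wins⇔ σ = mk⇔ ⇒ ⇐
        where
        X = called σ t
        ⇒ : WinsInRound M C t σ → Any (λ p → Plays p σ) pairs
        ⇒ wins@(C⊆X , _) with unique , e∈C ← to (wins-iff-unique i σ) wins = lose
          (∈-cartesianProduct⁺
            (∈-filter⁺ (in𝓘? M C k) (∈-subsets (X ∩ ∁ C))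
              (∣S∣≡k , p∩q⊆q X (∁ C) , subst (IsUniqueCircuitIn M C) (sym ([p∩∁q]∪q≡p C⊆X)) unique))
            (∈-filter⁺ (_∈? C) (∈-allFin _) e∈C))
          ((λ {_} → C⊆X) , refl , refl)
          where
          ∣S∣≡k : ∣ X ∩ ∁ C ∣ ≡ k
          ∣S∣≡k = begin
            ∣ X ∩ ∁ C ∣                   ≡⟨ ℕ.m+n∸n≡m _ ∣ C ∣ ⟨
            ∣ X ∩ ∁ C ∣ + ∣ C ∣ ∸ ∣ C ∣   ≡⟨ cong (_∸ ∣ C ∣) (∣∪C∣ (p∩q⊆q X (∁ C))) ⟨
            ∣ (X ∩ ∁ C) ∪ C ∣ ∸ ∣ C ∣     ≡⟨ cong (λ Y → ∣ Y ∣ ∸ ∣ C ∣) ([p∩∁q]∪q≡p C⊆X) ⟩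
            ∣ X ∣ ∸ ∣ C ∣                 ≡⟨ cong (_∸ ∣ C ∣) (∣called∣ σ (toℕ<n i)) ⟩
            k                             ∎
        ⇐ : Any (λ p → Plays p σ) pairs → WinsInRound M C t σ
        ⇐ any with (_ , _) , p∈pairs , C⊆X , refl , refl ← find any
              with S∈ , e∈ ← ∈-cartesianProduct⁻ (𝓘 M C k) elements p∈pairs
              with _ , _ , _ , unique ← ∈-filter⁻ (in𝓘? M C k) {xs = subsets n} S∈ =
          from (wins-iff-unique i σ)
            (subst (IsUniqueCircuitIn M C) ([p∩∁q]∪q≡p C⊆X) unique , proj₂ (∈-filter⁻ (_∈? C) {xs = allFin n} e∈))

      count-plays : ∀ {p} → p List.∈ pairs → count (plays? p) (permutations n) ≡ c
      count-plays {S , e} p∈pairs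
        with S∈ , e∈ ← ∈-cartesianProduct⁻ (𝓘 M C k) elements p∈pairs
        with _ , ∣S∣≡k , S⊆∁C , _ ← ∈-filter⁻ (in𝓘? M C k) {xs = subsets n} S∈ =
        -- The bound `∣C∣≤t` makes the truncated difference `k` exact, so `S ∪ C` has size `t`.
        count-arrangements i (S ∪ C) e
          (trans (∣∪C∣ S⊆∁C) (trans (cong (_+ ∣ C ∣) ∣S∣≡k) (ℕ.m∸n+n≡m ∣C∣≤t)))
          (q⊆p∪q S C (proj₂ (∈-filter⁻ (_∈? C) {xs = allFin n} e∈)))
          (plays? (S , e)) plays⇔
        where
        plays⇔ : ∀ σ → Plays (S , e) σ ⇔ Arranges i (S ∪ C) e σ
        plays⇔ σ = mk⇔
          (λ { (C⊆X , refl , refl) →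
               subst (λ X → Arranges i X e σ) (sym ([p∩∁q]∪q≡p C⊆X)) (called-arranges σ i) })
          (λ arr → let X≡ = arranges⇒called {σ = σ} arr in
            (λ {_} x∈C → subst (_ ∈_) (sym X≡) (q⊆p∪q S C x∈C)) ,
            trans (cong (_∩ ∁ C) X≡) ([p∪q]∩∁q≡p S⊆∁C) , proj₂ arr)

    -- Summing over the possible winning rounds.

    in-round⇒wins : ∀ {σ} t → 0 < t → t ≤ n → WinsInRound M C t σ → Wins M C σ
    in-round⇒wins {σ} (suc t) _ t<n wins =
      -- `Wins` indexes rounds by positions, one less than the round number.
      fromℕ< t<n , subst (λ s → WinsInRound M C (suc s) σ) (sym (toℕ-fromℕ< t<n)) wins

    rank+1≤n : rank M + 1 ≤ n
    rank+1≤n = subst (_≤ n) (ℕ.+-comm 1 (rank M)) (rank<n M C∈𝓒)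

    -- Every win falls in exactly one round, and size and rank confine that round to the stated
    -- range; `k` is the offset of the round from `∣ C ∣`.
    count-wins :
      count (wins? M C) (permutations n) ≡
      sum (applyUpTo (λ k → count (winsInRound? M C (∣ C ∣ + k)) (permutations n)) (suc (rank M + 1) ∸ ∣ C ∣))
    count-wins = trans
      (count-partition (wins? M C) (winsInRound? M C) (applyUpTo rounds m) wins⇔ disjoint (permutations n))
      (cong sum (map-applyUpTo rounds _ m))
      where
      m : ℕ
      m = suc (rank M + 1) ∸ ∣ C ∣
      rounds : ℕ → ℕ
      rounds k = ∣ C ∣ + k

      disjoint : AllPairs (λ s t → ∀ σ → WinsInRound M C s σ → ¬ WinsInRound M C t σ)
                          (applyUpTo rounds m)
      -- A win in an earlier round leaves `C` inside the set called just before the later round,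
      -- which then is not independent.
      disjoint = AllPairs.applyUpTo⁺₁ rounds m λ i<j _ σ (C⊆ , _) (_ , ind) →
        ind (C , C∈𝓒 , λ {_} → called-mono σ (ℕ.∸-monoˡ-≤ 1 (ℕ.+-monoʳ-< ∣ C ∣ i<j)) ∘ C⊆)

      wins⇔ : ∀ σ → Wins M C σ ⇔ Any (λ t → WinsInRound M C t σ) (applyUpTo rounds m)
      wins⇔ σ = mk⇔ ⇒ ⇐
        where
        ⇒ : Wins M C σ → Any (λ t → WinsInRound M C t σ) (applyUpTo rounds m)
        ⇒ (i , wins@(C⊆ , ind)) = Any.applyUpTo⁺ rounds
          (subst (λ t → WinsInRound M C t σ) (sym (ℕ.m+[n∸m]≡n ∣C∣≤t)) wins)
          (ℕ.∸-monoˡ-< (s≤s t≤rank+1) ∣C∣≤t)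
          where
          ∣C∣≤t : ∣ C ∣ ≤ suc (toℕ i)
          ∣C∣≤t = subst (∣ C ∣ ≤_) (∣called∣ σ (toℕ<n i)) (p⊆q⇒∣p∣≤∣q∣ C⊆)
          t≤rank+1 : suc (toℕ i) ≤ rank M + 1
          -- Independence concerns the `toℕ i` elements before the winning call, hence the extra one
          -- above the rank.
          t≤rank+1 = subst (suc (toℕ i) ≤_) (ℕ.+-comm 1 (rank M)) (s≤s
            (subst (_≤ rank M) (∣called∣ σ (ℕ.<⇒≤ (toℕ<n i))) (∣independent∣≤rank ind)))
        ⇐ : Any (λ t → WinsInRound M C t σ) (applyUpTo rounds m) → Wins M C σ
        ⇐ any with k , k<m , wins ← Any.applyUpTo⁻ rounds any =
          in-round⇒wins {σ} (∣ C ∣ + k) (ℕ.<-≤-trans ∣C∣>0 (ℕ.m≤m+n ∣ C ∣ k))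
            -- If `∣ C ∣ + k` exceeded `rank M + 1`, then `k` would be at least `m`.
            (ℕ.≤-trans (s≤s⁻¹ (ℕ.≰⇒> λ r+1< → ℕ.<⇒≱ k<m (ℕ.m≤n+o⇒m∸n≤o _ ∣ C ∣ r+1<))) rank+1≤n)
            wins

    -- The product on the right is collected into one fraction; cross-multiplication leaves an
    -- identity of natural numbers that follows from `count-winning` and the factorial identity.
    βᵣ-formula : .{{_ : NonZero n}} (i : Fin n) .{{_ : NonZero ((n ∸ 1) choose toℕ i)}} →
      ∣ C ∣ ≤ suc (toℕ i) →
      βᵣ M C (suc (toℕ i)) ≡
        (+ ∣ C ∣ / n) * (+ length (𝓘 M C (suc (toℕ i) ∸ ∣ C ∣)) / 1) * (+ 1 / ((n ∸ 1) choose toℕ i))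
    βᵣ-formula i ∣C∣≤t = begin
      βᵣ M C (suc (toℕ i))
        ≡⟨ /-cross (count (winsInRound? M C (suc (toℕ i))) (permutations n)) N
                   (∣ C ∣ ℕ.* I ℕ.* 1) (n ℕ.* 1 ℕ.* b) cross ⟩
      + (∣ C ∣ ℕ.* I ℕ.* 1) / (n ℕ.* 1 ℕ.* b)
        ≡⟨ /-*-/ (∣ C ∣ ℕ.* I) (n ℕ.* 1) 1 b ⟨
      (+ (∣ C ∣ ℕ.* I) / (n ℕ.* 1)) * (+ 1 / b)
        ≡⟨ cong (_* (+ 1 / b)) (/-*-/ ∣ C ∣ n I 1) ⟨
      (+ ∣ C ∣ / n) * (+ I / 1) * (+ 1 / b)
        ∎
      where
      open ≡-Reasoning
      I b N q : ℕ
      I = length (𝓘 M C (suc (toℕ i) ∸ ∣ C ∣))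
      b = (n ∸ 1) choose toℕ i
      N = length (permutations n)
      q = toℕ i ! ℕ.* (n ∸ suc (toℕ i)) !
      instance
        N≢0 : NonZero N
        N≢0 = subst NonZero (sym (length-permutations n)) (n ℕ.!≢0)
        n*1≢0 : NonZero (n ℕ.* 1)
        n*1≢0 = ℕ.m*n≢0 n 1
        n*1*b≢0 : NonZero (n ℕ.* 1 ℕ.* b)
        n*1*b≢0 = ℕ.m*n≢0 (n ℕ.* 1) b
      rearrange : ∀ I c q n b → I ℕ.* c ℕ.* q ℕ.* (n ℕ.* 1 ℕ.* b) ≡ c ℕ.* I ℕ.* 1 ℕ.* (n ℕ.* (b ℕ.* q))
      rearrange = solve-∀
      cross : count (winsInRound? M C (suc (toℕ i))) (permutations n) ℕ.* (n ℕ.* 1 ℕ.* b) ≡ ∣ C ∣ ℕ.* I ℕ.* 1 ℕ.* N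
      cross = begin
        count (winsInRound? M C (suc (toℕ i))) (permutations n) ℕ.* (n ℕ.* 1 ℕ.* b)
          ≡⟨ cong (ℕ._* (n ℕ.* 1 ℕ.* b)) (count-winning i ∣C∣≤t) ⟩
        I ℕ.* ∣ C ∣ ℕ.* q ℕ.* (n ℕ.* 1 ℕ.* b)
          ≡⟨ rearrange I ∣ C ∣ q n b ⟩
        ∣ C ∣ ℕ.* I ℕ.* 1 ℕ.* (n ℕ.* (b ℕ.* q))
          ≡⟨ cong (∣ C ∣ ℕ.* I ℕ.* 1 ℕ.*_) (trans (n*[n-1]Ci*i![n-1-i]!≡n! i) (sym (length-permutations n))) ⟩
        ∣ C ∣ ℕ.* I ℕ.* 1 ℕ.* N
          ∎

theorem2 : ∀ {n : ℕ} (M : Matroid n) (C : Subset n) (C∈𝓒 : Circuit M C) →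
  (β M C ≡ ∑[ ∣ C ∣ ⋯ rank M + 1 ] (βᵣ M C)) ×
  (∀ (t : ℕ) → ∣ C ∣ ≤ t → (t≤r+1 : t ≤ rank M + 1) →
    βᵣ M C t ≡
      (+ ∣ C ∣ / n) {{ground-nonZero M C∈𝓒}}
      * (+ length (𝓘 M C (t ∸ ∣ C ∣)) / 1)
      * (+ 1 / ((n ∸ 1) choose (t ∸ 1))) {{round-choose-nonZero M C∈𝓒 t≤r+1}})
theorem2 {n} M C C∈𝓒 = total , round
  where
  instance
    N≢0 : NonZero (length (permutations n))
    N≢0 = subst NonZero (sym (length-permutations n)) (n ℕ.!≢0)
    n≢0 : NonZero n
    n≢0 = ground-nonZero M C∈𝓒
  total : β M C ≡ ∑[ ∣ C ∣ ⋯ rank M + 1 ] (βᵣ M C)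
  total = trans (cong (λ m → + m / length (permutations n)) (count-wins M C∈𝓒)) (sym
    (∑-/ (λ k → count (winsInRound? M C (∣ C ∣ + k)) (permutations n)) _ (suc (rank M + 1) ∸ ∣ C ∣)))
  round : ∀ t → ∣ C ∣ ≤ t → (t≤r+1 : t ≤ rank M + 1) → βᵣ M C t ≡
    (+ ∣ C ∣ / n) * (+ length (𝓘 M C (t ∸ ∣ C ∣)) / 1)
    * (+ 1 / ((n ∸ 1) choose (t ∸ 1))) {{round-choose-nonZero M C∈𝓒 t≤r+1}}
  -- Round zero is excluded because a circuit is nonempty.
  round zero    ∣C∣≤0 _     = contradiction (ℕ.<-≤-trans (∣C∣>0 M C∈𝓒) ∣C∣≤0) λ ()
  -- `Formula` quantifies over the nonzero proof because the type of that proof changes when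
  -- `toℕ (fromℕ< t<n)` is rewritten to `t`.
  round (suc t) ∣C∣≤t t≤r+1 = subst Formula (toℕ-fromℕ< t<n)
    (λ b≢0 ∣C∣≤t → βᵣ-formula M C∈𝓒 (fromℕ< t<n) {{b≢0}} ∣C∣≤t)
    (round-choose-nonZero M C∈𝓒 t≤r+1) ∣C∣≤t
    where
    t<n : t < n
    t<n = ℕ.≤-trans t≤r+1 (rank+1≤n M C∈𝓒)
    Formula : ℕ → Set
    Formula t = (b≢0 : NonZero ((n ∸ 1) choose t)) → ∣ C ∣ ≤ suc t → βᵣ M C (suc t) ≡
      (+ ∣ C ∣ / n) * (+ length (𝓘 M C (suc t ∸ ∣ C ∣)) / 1) * (+ 1 / ((n ∸ 1) choose t)) {{b≢0}}
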